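{- For every odd integer $n\ge 3$, the cycle $C_n$ on $n$ vertices satisfies \[ \underline{\mathrm{scs}}(C_n)=\frac{n+1}{2}. \]
   Context: $[k]=\{1,\dots,k\}$ and $\chi(G)$ is the chromatic number of a graph $G=(V,E)$. For a proper coloring $c:V\to[\chi(G)]$, a determining set for $(G,c)$ is a set $S\subseteq V$ such that for every proper coloring $c':V\to[\chi(G)]$ of $G$, if $c'|_S=c|_S$ then $c'=c$ on all of $V$. A critical set for $(G,c)$ is a determining set for $(G,c)$ that is minimal under inclusion. Define $\mathrm{scs}(G,c)=\min\{|X| : X \text{ is a critical set for } (G,c)\}$ and $\underline{\mathrm{scs}}(G)=\min_c \mathrm{scs}(G,c)$, where the minimum is over all proper colorings $c:V\to[\chi(G)]$. -}

module Defs where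

open import Data.Fin using (Fin; toℕ)
open import Data.Fin.Properties using (toℕ<n)
open import Data.Fin.Subset using (Subset; _∈_; _⊂_; ∣_∣)
open import Data.Nat using (ℕ; suc; _≤_; _%_; z≤n; s≤s; NonZero; >-nonZero)
open import Data.Nat.DivMod using (m<n⇒m%n≡m; n%n≡0)
open import Data.Nat.Properties
  using (≤-trans; <-irrefl; m≤n⇒m<n∨m≡n; 1+n≢n; _≟_)
open import Data.Product using (∃; _×_)
open import Data.Sum using (_⊎_; inj₁; inj₂; swap)
open import Level using (Level)
open import Relation.Binary.Definitions using (Decidable; Symmetric; Irreflexive)
open import Relation.Binary.PropositionalEquality
  using (_≡_; _≢_; refl; sym; trans; cong)
open import Relation.Nullary using (¬_)
open import Relation.Nullary.Decidable using (_⊎-dec_)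
open import Relation.Unary using (Pred)

private
  variable
    ℓ : Level
    n k : ℕ

-- Adjacency is decidable, so that a graph is genuine finite data.
record Graph (n : ℕ) : Set₁ where
  infix 4 _~_ _~?_
  field
    _~_     : Fin n → Fin n → Set
    _~?_    : Decidable _~_
    ~-sym   : Symmetric _~_
    ~-irrefl : Irreflexive _≡_ _~_

-- Minima are relational: IsMin P m reads "min P exists and equals m".
IsMin : Pred ℕ ℓ → Pred ℕ ℓ
IsMin P m = P m × (∀ j → P j → m ≤ j)

module _ (G : Graph n) where
  open Graph G

  -- The palette [k] is represented by Fin k.
  Proper : (Fin n → Fin k) → Set
  Proper c = ∀ u v → u ~ v → c u ≢ c v

  Colorable : Pred ℕ _
  Colorable k = ∃ λ (c : Fin n → Fin k) → Proper c

  IsChromaticNumber : Pred ℕ _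
  IsChromaticNumber = IsMin Colorable

  -- c' ranges over colorings with the same palette as c, and equality of
  -- colorings is pointwise.
  Determining : (Fin n → Fin k) → Pred (Subset n) _
  Determining {k = k} c S =
    ∀ (c' : Fin n → Fin k) → Proper c' →
    (∀ v → v ∈ S → c' v ≡ c v) → ∀ v → c' v ≡ c v

  Critical : (Fin n → Fin k) → Pred (Subset n) _
  Critical c S = Determining c S × (∀ T → T ⊂ S → ¬ Determining c T)

  IsScs : (Fin n → Fin k) → Pred ℕ _
  IsScs c = IsMin λ s → ∃ λ X → Critical c X × ∣ X ∣ ≡ s

  -- The palette size is the chromatic number, which is unique as a minimum.
  IsMinScs : Pred ℕ _
  IsMinScs m = ∃ λ χ → IsChromaticNumber χ ×
    IsMin (λ s → ∃ λ (c : Fin n → Fin χ) → Proper c × IsScs c s) m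

module _ (n : ℕ) .{{_ : NonZero n}} where

  Next : Fin n → Fin n → Set
  Next i j = toℕ j ≡ suc (toℕ i) % n

  Next-irrefl : 3 ≤ n → ∀ i → ¬ Next i i
  Next-irrefl 3≤n i eq with m≤n⇒m<n∨m≡n (toℕ<n i)
  ... | inj₁ 1+i<n = 1+n≢n (sym (trans eq (m<n⇒m%n≡m 1+i<n)))
  ... | inj₂ 1+i≡n = <-irrefl 1≡n (≤-trans (s≤s (s≤s z≤n)) 3≤n)
    where
    i≡0 : toℕ i ≡ 0
    i≡0 = trans eq (trans (cong (_% n) 1+i≡n) (n%n≡0 n))
    1≡n : 1 ≡ n
    1≡n = trans (cong suc (sym i≡0)) 1+i≡n

-- The cycle 0 — 1 — ⋯ — (n-1) — 0; it is a simple graph on n vertices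
-- with n edges only for n ≥ 3.
cycle : ∀ n → 3 ≤ n → Graph n
cycle n 3≤n = record
  { _~_      = λ i j → Next n i j ⊎ Next n j i
  ; _~?_     = λ i j → (toℕ j ≟ suc (toℕ i) % n) ⊎-dec (toℕ i ≟ suc (toℕ j) % n)
  ; ~-sym    = swap
  ; ~-irrefl = λ { {i} refl (inj₁ p) → Next-irrefl n 3≤n i p
                 ; {i} refl (inj₂ p) → Next-irrefl n 3≤n i p }
  }
  where
  instance
    n≢0 : NonZero n
    n≢0 = >-nonZero (≤-trans (s≤s z≤n) 3≤n)

{-# OPTIONS --safe #-}

-- A set determines a proper 3-coloring c of the cycle only if it meets every
-- edge: whatever the outer neighbours of an edge are colored, its two ends can
-- be recolored. A vertex cover of C_{2k+1} has at least k+1 elements.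
-- Conversely, take a coloring in which the even vertices, in cyclic order, are
-- colored with consecutive colors distinct: each odd vertex then sees two
-- colors, so the k+1 even vertices determine c. A determining set of minimum
-- size is critical.
module Submission where

open import Data.Bool using (true; false)
open import Data.Empty using (⊥)
open import Data.Fin using (Fin; zero; suc; toℕ; fromℕ; fromℕ<; inject₁; inject≤)
open import Data.Fin.Patterns using (0F; 1F; 2F)
open import Data.Fin.Properties
  using (toℕ<n; toℕ-fromℕ; toℕ-fromℕ<; toℕ-inject₁; toℕ-injective; inject≤-injective; all?; any?)
  renaming (_≟_ to _≟ᶠ_)
open import Data.Fin.Subset using (Subset; inside; outside; _∈_; ∣_∣)
open import Data.Fin.Subset.Properties using (_∈?_; drop-there; p⊂q⇒∣p∣<∣q∣)
open import Data.Nat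
open import Data.Nat.Divisibility using (_∣_; m%n≡0⇒n∣m)
open import Data.Nat.DivMod using (m<n⇒m%n≡m; n%n≡0; m%n<n; m*n/n≡m; m≡m%n+[m/n]*n)
open import Data.Nat.Properties
open import Data.Product using (∃; ∃₂; _×_; _,_)
open import Data.Sum using (_⊎_; inj₁; inj₂; [_,_]′; map)
open import Data.Vec using ([]; _∷_; here; there)
open import Data.Vec.Functional using (updateAt)
open import Data.Vec.Functional.Properties using (updateAt-updates; updateAt-minimal)
open import Function using (_∘_; const)
open import Relation.Binary.PropositionalEquality
open import Relation.Nullary using (¬_; yes; no; contradiction)
open import Relation.Nullary.Decidable using (toWitness; ¬?; _×-dec_; _→-dec_)
open import Defs

-- Parity of natural numbers.

odd⇒1+[k*2] : ∀ n → ¬ (2 ∣ n) → ∃ λ k → n ≡ suc (k * 2)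
odd⇒1+[k*2] n 2∤n with n % 2 in eq | m%n<n n 2 | m≡m%n+[m/n]*n n 2
... | 0 | _ | _ = contradiction (m%n≡0⇒n∣m n 2 eq) 2∤n
... | 1 | _ | n≡ = n / 2 , n≡
... | suc (suc _) | s≤s (s≤s ()) | _

even⊎odd : ∀ v → ∃ λ a → v ≡ a * 2 ⊎ v ≡ suc (a * 2)
even⊎odd zero = 0 , inj₁ refl
even⊎odd (suc zero) = 0 , inj₂ refl
even⊎odd (suc (suc v)) with even⊎odd v
... | a , p = suc a , map (cong (2 +_)) (cong (2 +_)) p

-- Neighbours on the directed cycle.

module _ {n : ℕ} .{{_ : NonZero n}} where

  next-cases : ∀ {i j : Fin n} → Next n i j →
               toℕ j ≡ suc (toℕ i) ⊎ (suc (toℕ i) ≡ n × toℕ j ≡ 0)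
  next-cases {i} eq with m≤n⇒m<n∨m≡n (toℕ<n i)
  ... | inj₁ 1+i<n = inj₁ (trans eq (m<n⇒m%n≡m 1+i<n))
  ... | inj₂ 1+i≡n = inj₂ (1+i≡n , trans eq (trans (cong (_% n) 1+i≡n) (n%n≡0 n)))

  next-suc : ∀ {i j : Fin n} → toℕ j ≡ suc (toℕ i) → Next n i j
  next-suc {j = j} eq = trans eq (sym (m<n⇒m%n≡m (subst (_< n) eq (toℕ<n j))))

  next-wrap : ∀ {i j : Fin n} → suc (toℕ i) ≡ n → toℕ j ≡ 0 → Next n i j
  next-wrap 1+i≡n j≡0 = trans j≡0 (sym (trans (cong (_% n) 1+i≡n) (n%n≡0 n)))

  next-functional : ∀ {i j k : Fin n} → Next n i j → Next n i k → j ≡ k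
  next-functional p q = toℕ-injective (trans p (sym q))

  next-injective : ∀ {i j k : Fin n} → Next n i k → Next n j k → i ≡ j
  next-injective {i} {j} p q = toℕ-injective (suc-injective (go (next-cases p) (next-cases q)))
    where
    go : _ → _ → suc (toℕ i) ≡ suc (toℕ j)
    go (inj₁ k≡1+i) (inj₁ k≡1+j) = trans (sym k≡1+i) k≡1+j
    go (inj₁ k≡1+i) (inj₂ (_ , k≡0)) = contradiction (trans (sym k≡0) k≡1+i) 0≢1+n
    go (inj₂ (_ , k≡0)) (inj₁ k≡1+j) = contradiction (trans (sym k≡0) k≡1+j) 0≢1+n
    go (inj₂ (1+i≡n , _)) (inj₂ (1+j≡n , _)) = trans 1+i≡n (sym 1+j≡n)

  next-asym : 3 ≤ n → ∀ {i j : Fin n} → Next n i j → ¬ Next n j i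
  next-asym 3≤n {i} {j} p q = go (next-cases p) (next-cases q)
    where
    go : _ → _ → ⊥
    go (inj₁ j≡1+i) (inj₁ i≡1+j) = m≢1+n+m (toℕ j) (trans j≡1+i (cong suc i≡1+j))
    go (inj₁ j≡1+i) (inj₂ (1+j≡n , i≡0)) =
      <⇒≢ 3≤n (trans (cong (2 +_) (sym i≡0)) (trans (cong suc (sym j≡1+i)) 1+j≡n))
    go (inj₂ (1+i≡n , j≡0)) (inj₁ i≡1+j) =
      <⇒≢ 3≤n (trans (cong (2 +_) (sym j≡0)) (trans (cong suc (sym i≡1+j)) 1+i≡n))
    go (inj₂ (1+i≡n , _)) (inj₂ (_ , i≡0)) =
      <⇒≢ (<⇒≤ 3≤n) (trans (cong suc (sym i≡0)) 1+i≡n)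

  successor : ∀ (i : Fin n) → ∃ (Next n i)
  successor i = fromℕ< (m%n<n (suc (toℕ i)) n) , toℕ-fromℕ< _

predecessor : ∀ {n} .{{_ : NonZero n}} (i : Fin n) → ∃ λ p → Next n p i
predecessor {suc m} zero = fromℕ m , next-wrap (cong suc (toℕ-fromℕ m)) refl
predecessor {suc m} (suc i) = inject₁ i , next-suc (cong suc (sym (toℕ-inject₁ i)))

-- Vertex covers of paths and cycles.

-- b counts an extra covered vertex to the right of the path.
path-cover-bound : ∀ {n} (S : Subset n) b →
  (∀ i j → toℕ j ≡ suc (toℕ i) → i ∈ S ⊎ j ∈ S) →
  (∀ i → suc (toℕ i) ≡ n → i ∈ S ⊎ 1 ≤ b) →
  n ≤ b + ∣ S ∣ * 2
path-cover-bound [] b cover end = z≤n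
path-cover-bound {suc n} (true ∷ S) b cover end = begin
  suc n                     ≤⟨ s≤s (path-cover-bound S b
                                 (λ i j eq → map drop-there drop-there
                                   (cover (suc i) (suc j) (cong suc eq)))
                                 (λ i eq → map drop-there (λ p → p) (end (suc i) (cong suc eq)))) ⟩
  suc (b + ∣ S ∣ * 2)       ≡⟨ +-suc b (∣ S ∣ * 2) ⟨
  b + suc (∣ S ∣ * 2)       ≤⟨ +-monoʳ-≤ b (n≤1+n _) ⟩
  b + suc ∣ S ∣ * 2         ∎
  where open ≤-Reasoning
path-cover-bound (false ∷ []) b cover end with end zero refl
... | inj₂ 1≤b = ≤-trans 1≤b (m≤m+n b 0)
path-cover-bound (false ∷ false ∷ S) b cover end with cover zero (suc zero) refl
... | inj₁ ()
... | inj₂ (there ())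
-- The covered second vertex pays for itself and for the uncovered vertex before it.
path-cover-bound {suc (suc n)} (false ∷ true ∷ S) b cover end = begin
  2 + n                     ≤⟨ s≤s (s≤s (path-cover-bound S b
                                 (λ i j eq → map (drop-there ∘ drop-there) (drop-there ∘ drop-there)
                                   (cover (suc (suc i)) (suc (suc j)) (cong (2 +_) eq)))
                                 (λ i eq → map (drop-there ∘ drop-there) (λ p → p)
                                   (end (suc (suc i)) (cong (2 +_) eq))))) ⟩
  2 + (b + ∣ S ∣ * 2)       ≡⟨ +-assoc 2 b _ ⟨
  2 + b + ∣ S ∣ * 2         ≡⟨ cong (_+ ∣ S ∣ * 2) (+-comm 2 b) ⟩
  b + 2 + ∣ S ∣ * 2         ≡⟨ +-assoc b 2 _ ⟩
  b + suc ∣ S ∣ * 2         ∎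
  where open ≤-Reasoning

-- Cut the cycle at vertex 0. If 0 is covered, it contributes 2: one for itself, and one as the
-- extra vertex `b = 1` to the right of the remaining path. If not, the closing edge puts the last
-- vertex into `S`, so `b = 0` suffices.
cycle-cover-bound : ∀ {n} .{{_ : NonZero n}} (S : Subset n) →
  (∀ i j → Next n i j → i ∈ S ⊎ j ∈ S) → n ≤ ∣ S ∣ * 2
cycle-cover-bound {suc n} (true ∷ S) cover = s≤s (path-cover-bound S 1
  (λ i j eq → map drop-there drop-there (cover (suc i) (suc j) (next-suc (cong suc eq))))
  (λ _ _ → inj₂ ≤-refl))
cycle-cover-bound {suc n} (false ∷ S) cover = path-cover-bound (false ∷ S) 0
  (λ i j eq → cover i j (next-suc eq))
  (λ i eq → [ inj₁ , (λ ()) ]′ (cover i zero (next-wrap eq refl)))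

-- Finite checks on colors.

abstract
  -- Each end has two admissible colors. At most two of the four pairs are monochromatic, so at
  -- least two pairs remain, one of them new.
  recolor-edge : ∀ (a d x y : Fin 3) → x ≢ a → y ≢ d → x ≢ y →
    ∃₂ λ x′ y′ → x′ ≢ a × y′ ≢ d × x′ ≢ y′ × ¬ (x′ ≡ x × y′ ≡ y)
  recolor-edge = toWitness
    {a? = all? λ a → all? λ d → all? λ x → all? λ y →
      ¬? (x ≟ᶠ a) →-dec ¬? (y ≟ᶠ d) →-dec ¬? (x ≟ᶠ y) →-dec
      any? λ x′ → any? λ y′ → ¬? (x′ ≟ᶠ a) ×-dec ¬? (y′ ≟ᶠ d) ×-dec ¬? (x′ ≟ᶠ y′) ×-dec
        ¬? ((x′ ≟ᶠ x) ×-dec (y′ ≟ᶠ y))} _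

third-color : ∀ (a b x y : Fin 3) → a ≢ b → x ≢ a → x ≢ b → y ≢ a → y ≢ b → x ≡ y
third-color = toWitness
  {a? = all? λ a → all? λ b → all? λ x → all? λ y →
    ¬? (a ≟ᶠ b) →-dec ¬? (x ≟ᶠ a) →-dec ¬? (x ≟ᶠ b) →-dec ¬? (y ≟ᶠ a) →-dec ¬? (y ≟ᶠ b) →-dec
    x ≟ᶠ y} _

other-color : ∀ (a x y : Fin 2) → x ≢ a → y ≢ a → x ≡ y
other-color = toWitness
  {a? = all? λ a → all? λ x → all? λ y → ¬? (x ≟ᶠ a) →-dec ¬? (y ≟ᶠ a) →-dec x ≟ᶠ y} _

-- Determining sets are vertex covers.

module _ {n : ℕ} (3≤n : 3 ≤ n) where

  private
    instance
      n≢0 : NonZero n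
      n≢0 = >-nonZero (≤-trans (s≤s z≤n) 3≤n)

    C : Graph n
    C = cycle n 3≤n

  proper-next : ∀ {k} {c : Fin n → Fin k} → (∀ u v → Next n u v → c u ≢ c v) → Proper C c
  proper-next p u v (inj₁ q) = p u v q
  proper-next p u v (inj₂ q) = p v u q ∘ sym

  determining⇒cover : ∀ {c : Fin n → Fin 3} {S} → Proper C c → Determining C c S →
                      ∀ i j → Next n i j → i ∈ S ⊎ j ∈ S
  determining⇒cover {c} {S} proper det i j i→j with i ∈? S | j ∈? S
  ... | yes i∈S | _ = inj₁ i∈S
  ... | no _ | yes j∈S = inj₂ j∈S
  ... | no i∉S | no j∉S
    -- The outer neighbours coincide when n is 3; the argument only uses that both lie off the edge.
    with p , p→i ← predecessor i | s , j→s ← successor j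
    with x , y , x≢cp , y≢cs , x≢y , xy≢ ← recolor-edge (c p) (c s) (c i) (c j)
           (proper i p (inj₂ p→i)) (proper j s (inj₁ j→s)) (proper i j (inj₁ i→j))
    = contradiction
        (trans (sym c′i) (agree i) , trans (sym c′j) (agree j)) xy≢
    where
    i≢j : i ≢ j
    i≢j refl = Next-irrefl n 3≤n i i→j

    c′ : Fin n → Fin 3
    c′ = updateAt (updateAt c i (const x)) j (const y)

    c′i : c′ i ≡ x
    c′i = trans (updateAt-minimal i j _ i≢j) (updateAt-updates i c)

    c′j : c′ j ≡ y
    c′j = updateAt-updates j _

    c′-other : ∀ {v} → v ≢ i → v ≢ j → c′ v ≡ c v
    c′-other v≢i v≢j = trans (updateAt-minimal _ j _ v≢j) (updateAt-minimal _ i c v≢i)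

    c′p : c′ p ≡ c p
    c′p = c′-other (λ { refl → Next-irrefl n 3≤n i p→i })
                   (λ { refl → next-asym 3≤n i→j p→i })

    c′s : c′ s ≡ c s
    c′s = c′-other (λ { refl → next-asym 3≤n i→j j→s })
                   (λ { refl → Next-irrefl n 3≤n j j→s })

    c′-next : ∀ u v → Next n u v → c′ u ≢ c′ v
    c′-next u v u→v eq with u ≟ᶠ i | u ≟ᶠ j | v ≟ᶠ i
    -- The edges meeting `i` or `j` are `i → j`, `j → s` and `p → i`, one per case; in the last case
    -- `v ≡ j` would force `u ≡ i`.
    ... | yes refl | _ | _ with refl ← next-functional u→v i→j =
      x≢y (trans (sym c′i) (trans eq c′j))
    ... | no _ | yes refl | _ with refl ← next-functional u→v j→s =
      y≢cs (trans (sym c′j) (trans eq c′s))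
    ... | no _ | no _ | yes refl with refl ← next-injective u→v p→i =
      x≢cp (trans (sym c′i) (trans (sym eq) c′p))
    ... | no u≢i | no u≢j | no v≢i =
      proper u v (inj₁ u→v)
        (trans (sym (c′-other u≢i u≢j))
          (trans eq (c′-other v≢i λ { refl → u≢i (next-injective u→v i→j) })))

    agree : ∀ v → c′ v ≡ c v
    agree = det c′ (proper-next c′-next)
      λ v v∈S → c′-other (λ { refl → i∉S v∈S }) (λ { refl → j∉S v∈S })

  determining-bound : ∀ {c : Fin n → Fin 3} {S} → Proper C c → Determining C c S → n ≤ ∣ S ∣ * 2
  determining-bound {S = S} proper det = cycle-cover-bound S (determining⇒cover proper det)

-- Odd cycles are not 2-colorable.

colorable-mono : ∀ {n j k} (G : Graph n) → j ≤ k → Colorable G j → Colorable G k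
colorable-mono G j≤k (c , proper) =
  (λ v → inject≤ (c v) j≤k) , λ u v u~v → proper u v u~v ∘ inject≤-injective j≤k j≤k _ _

-- With two colors, vertices two steps apart agree. Hence the last vertex `k * 2` has the color of
-- its neighbour 0.
odd-cycle-not-2-colorable : ∀ k (3≤n : 3 ≤ suc (k * 2)) → ¬ Colorable (cycle (suc (k * 2)) 3≤n) 2
odd-cycle-not-2-colorable k 3≤n (c , proper) =
  proper (fromℕ (k * 2)) zero (inj₁ (next-wrap (cong suc (toℕ-fromℕ (k * 2))) refl))
    (even-vertex k (fromℕ (k * 2)) (toℕ-fromℕ (k * 2)))
  where
  even-vertex : ∀ a (v : Fin (suc (k * 2))) → toℕ v ≡ a * 2 → c v ≡ c zero
  even-vertex zero v v≡0 = cong c (toℕ-injective v≡0)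
  even-vertex (suc a) v v≡2+2a
    with u , u→v ← predecessor v
    with t , t→u ← predecessor u =
    trans (other-color (c u) (c v) (c t) (proper v u (inj₂ u→v)) (proper t u (inj₁ t→u)))
          (even-vertex a t t≡2a)
    where
    pred-suc : ∀ {i j : Fin (suc (k * 2))} {m} → Next _ i j → toℕ j ≡ suc m → toℕ i ≡ m
    pred-suc i→j j≡1+m with next-cases i→j
    ... | inj₁ j≡1+i = suc-injective (trans (sym j≡1+i) j≡1+m)
    ... | inj₂ (_ , j≡0) = contradiction (trans (sym j≡0) j≡1+m) 0≢1+n
    t≡2a : toℕ t ≡ a * 2
    t≡2a = pred-suc t→u (pred-suc u→v v≡2+2a)

-- The extremal coloring and its even vertices.

-- Even positions alternate `0F` and `1F`, and odd ones are `2F`. Recursion in steps of four reduces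
-- the facts below to one period.
zigzag : ℕ → Fin 3
zigzag 0 = 0F
zigzag 1 = 2F
zigzag 2 = 1F
zigzag 3 = 2F
zigzag (suc (suc (suc (suc i)))) = zigzag i

-- Colors 2 1 0 2 1 2 0 2 1 2 0 2 …, so that the even vertices have
-- colors 2 0 1 0 1 ….
color : ℕ → Fin 3
color 0 = 2F
color 1 = 1F
color (suc (suc i)) = zigzag i

zigzag-suc : ∀ i → zigzag i ≢ zigzag (suc i)
zigzag-suc 0 ()
zigzag-suc 1 ()
zigzag-suc 2 ()
zigzag-suc 3 ()
zigzag-suc (suc (suc (suc (suc i)))) = zigzag-suc i

color-suc : ∀ i → color i ≢ color (suc i)
color-suc 0 ()
color-suc 1 ()
color-suc (suc (suc i)) = zigzag-suc i

zigzag-even : ∀ a → zigzag (a * 2) ≢ zigzag (suc a * 2)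
zigzag-even 0 ()
zigzag-even 1 ()
zigzag-even (suc (suc a)) = zigzag-even a

zigzag-even≢2F : ∀ a → zigzag (a * 2) ≢ 2F
zigzag-even≢2F 0 ()
zigzag-even≢2F 1 ()
zigzag-even≢2F (suc (suc a)) = zigzag-even≢2F a

color-even : ∀ a → color (a * 2) ≢ color (suc a * 2)
color-even 0 ()
color-even (suc a) = zigzag-even a

-- The closing edge joins two even vertices. Color `2F` at vertex 0 recurs at no later even vertex,
-- so the parity of `k` does not matter.
last-color : ∀ k → 3 ≤ suc (k * 2) → color (k * 2) ≢ color 0
last-color zero (s≤s ())
last-color (suc k) _ = zigzag-even≢2F k

evens : ∀ k → Subset (suc (k * 2))
evens zero = inside ∷ []
evens (suc k) = inside ∷ outside ∷ evens k

∣evens∣ : ∀ k → ∣ evens k ∣ ≡ suc k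
∣evens∣ zero = refl
∣evens∣ (suc k) = cong suc (∣evens∣ k)

even∈evens : ∀ k a (v : Fin (suc (k * 2))) → toℕ v ≡ a * 2 → v ∈ evens k
even∈evens zero a zero _ = here
even∈evens (suc k) a zero _ = here
even∈evens (suc k) zero (suc zero) ()
even∈evens (suc k) (suc a) (suc zero) ()
even∈evens (suc k) (suc a) (suc (suc v)) eq =
  there (there (even∈evens k a v (suc-injective (suc-injective eq))))

-- The value for odd cycles.

module _ (k : ℕ) (3≤n : 3 ≤ suc (k * 2)) where

  private
    n : ℕ
    n = suc (k * 2)

    C : Graph n
    C = cycle n 3≤n

    c : Fin n → Fin 3
    c v = color (toℕ v)

  color-proper : Proper C c
  color-proper = proper-next 3≤n λ u v u→v → go u v (next-cases u→v)
    where
    go : ∀ u v → _ → c u ≢ c v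
    go u v (inj₁ v≡1+u) = subst (λ w → c u ≢ color w) (sym v≡1+u) (color-suc (toℕ u))
    go u v (inj₂ (1+u≡n , v≡0)) =
      subst₂ (λ t w → color t ≢ color w) (sym (suc-injective 1+u≡n)) (sym v≡0) (last-color k 3≤n)

  evens-determining : Determining C c (evens k)
  evens-determining c′ proper′ agree v with even⊎odd (toℕ v)
  ... | a , inj₁ v≡2a = agree v (even∈evens k a v v≡2a)
  ... | a , inj₂ v≡1+2a
    with u , u→v ← predecessor v
    with w , v→w ← successor v =
    third-color (c u) (c w) (c′ v) (c v)
      (subst₂ (λ s t → color s ≢ color t) (sym u≡2a) (sym w≡2+2a) (color-even a))
      (λ eq → proper′ v u (inj₂ u→v) (trans eq (sym (agree u (even∈evens k a u u≡2a)))))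
      (λ eq → proper′ v w (inj₁ v→w) (trans eq (sym (agree w (even∈evens k (suc a) w w≡2+2a)))))
      (color-proper v u (inj₂ u→v))
      (color-proper v w (inj₁ v→w))
    where
    u≡2a : toℕ u ≡ a * 2
    u≡2a with next-cases u→v
    ... | inj₁ v≡1+u = suc-injective (trans (sym v≡1+u) v≡1+2a)
    ... | inj₂ (_ , v≡0) = contradiction (trans (sym v≡0) v≡1+2a) 0≢1+n
    w≡2+2a : toℕ w ≡ suc a * 2
    w≡2+2a with next-cases v→w
    ... | inj₁ w≡1+v = trans w≡1+v (cong suc v≡1+2a)
    -- The last vertex is `k * 2`, so an odd vertex never has the wrap-around successor.
    ... | inj₂ (1+v≡n , _) = contradiction
      (trans (*-comm 2 k) (trans (sym (suc-injective 1+v≡n)) (trans v≡1+2a (cong suc (*-comm a 2)))))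
      (even≢odd k a)

  chromatic-number : IsChromaticNumber C 3
  chromatic-number = (c , color-proper) , λ j colorable →
    -- Palettes of size below 3 embed into two colors, so excluding two excludes them all.
    ≮⇒≥ λ j<3 → odd-cycle-not-2-colorable k 3≤n (colorable-mono C (s≤s⁻¹ j<3) colorable)

  determining-size : ∀ {c : Fin n → Fin 3} {S} → Proper C c → Determining C c S → suc k ≤ ∣ S ∣
  -- `suc (k * 2) ≤ ∣ S ∣ * 2` is a strict inequality between doubles; cancelling 2 gives the half
  -- rounded up.
  determining-size proper det = *-cancelʳ-< 2 k _ (determining-bound 3≤n proper det)

  evens-critical : Critical C c (evens k)
  evens-critical = evens-determining , λ T T⊂E det →
    <⇒≱ (subst (∣ T ∣ <_) (∣evens∣ k) (p⊂q⇒∣p∣<∣q∣ T⊂E)) (determining-size color-proper det)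

  min-scs : IsMinScs C (suc k)
  min-scs = 3 , chromatic-number ,
    -- `critical-size` holds for every proper coloring, so it bounds both minima: over the critical
    -- sets of `c` and over colorings.
    (c , color-proper , (evens k , evens-critical , ∣evens∣ k) , λ _ → critical-size color-proper) ,
    λ { s (_ , proper , scs , _) → critical-size proper scs }
    where
    critical-size : ∀ {c : Fin n → Fin 3} {s} → Proper C c →
                    (∃ λ X → Critical C c X × ∣ X ∣ ≡ s) → suc k ≤ s
    critical-size proper (X , (det , _) , refl) = determining-size proper det

theorem6 : (n : ℕ) (3≤n : 3 ≤ n) → ¬ (2 ∣ n) → IsMinScs (cycle n 3≤n) ((n + 1) / 2)
theorem6 n 3≤n 2∤n with k , refl ← odd⇒1+[k*2] n 2∤n =
  subst (IsMinScs (cycle n 3≤n)) (sym half) (min-scs k 3≤n)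
  where
  half : (suc (k * 2) + 1) / 2 ≡ suc k
  -- `1 + suc (k * 2)` computes to `suc k * 2`.
  half = trans (cong (_/ 2) (+-comm (suc (k * 2)) 1)) (m*n/n≡m (suc k) 2)
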